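{- Let $q\ge 4$ be even and $n\ge 3$ be odd. There does not exist an ordering $G(0),G(1),\ldots,G(q^n-1)$ of all of $\mathbb{Z}_q^n$ (indices taken modulo $q^n$) such that consecutive words $G(i),G(i+1)$ are at Lee distance $1$, and such that for every $i$ there is $\epsilon_i\in\{1,-1\}$ with $G(i)+(1,1,\ldots,1)=G(i+q^{n-1}+\epsilon_i)$.
   Context: The Lee distance between $v=(v_1,\ldots,v_n)$ and $u=(u_1,\ldots,u_n)$ in $\mathbb{Z}_q^n$ is $\sum_{i=1}^n \min\{|v_i-u_i|,\,q-|v_i-u_i|\}$, where $v_i,u_i$ are regarded as integers in $\{0,\ldots,q-1\}$. Addition of words is componentwise in $\mathbb{Z}_q$. -}

module Defs where

open import Data.Fin.Base using (Fin; toℕ; fromℕ<)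
open import Data.Integer.Base using (ℤ)
open import Data.Integer.DivMod using (n%ℕd<d)
open import Data.Nat.Base using (ℕ; NonZero; _+_; _∸_; _⊓_; ∣_-_∣)
open import Data.Nat.DivMod using (_mod_)
open import Data.Vec.Base using (Vec; replicate; sum; zipWith)

-- ℤ_q is represented by its residues {0, …, q-1}.
Word : ℕ → ℕ → Set
Word q n = Vec (Fin q) n

leeDist₁ : ∀ {q} → Fin q → Fin q → ℕ
leeDist₁ {q} a b = ∣ toℕ a - toℕ b ∣ ⊓ (q ∸ ∣ toℕ a - toℕ b ∣)

leeDist : ∀ {q n} → Word q n → Word q n → ℕ
leeDist v u = sum (zipWith leeDist₁ v u)

infixl 6 _⊕₁_ _⊕_

_⊕₁_ : ∀ {q} .{{_ : NonZero q}} → Fin q → Fin q → Fin q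
_⊕₁_ {q} a b = (toℕ a + toℕ b) mod q

_⊕_ : ∀ {q n} .{{_ : NonZero q}} → Word q n → Word q n → Word q n
_⊕_ = zipWith _⊕₁_

𝟏 : ∀ {q n} .{{_ : NonZero q}} → Word q n
𝟏 {q} {n} = replicate n (1 mod q)

-- The representative in {0, …, m-1} of an integer index taken modulo m.
-- (_%ℕ_ is the Euclidean remainder, so it is non-negative also for negative k.)
index : ∀ m .{{_ : NonZero m}} → ℤ → Fin m
index m k = fromℕ< (n%ℕd<d k m)

{-# OPTIONS --safe #-}
module Submission where

{- Let d i be the i-th step, a unit vector, and M = q ^ (n - 1). Injectivity of G forces the sign
   ε i to depend only on the parity of i. Equal signs on both parities would make q applications
   of the shift by 𝟏 move the index by ± q modulo q ^ n, so the signs alternate, say + on even i.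
   Comparing neighbouring instances gives, for even i,
     d (i + M) = - d i   and   d (i + M + 1) = d i + d (i + 1) + d (i + 2).
   As q ≥ 4 and the walk never backtracks, a sum of three consecutive steps is a unit vector only
   if either d (i + 2) = - d i with d (i + 1) along another axis, or the three steps are equal
   (for q = 4). So all even steps lie on one axis j, and 2 · (G i)ⱼ + (d i)ⱼ modulo 4 is the same
   for all even i. But passing from i to i + M changes it by 2. -}

open import Defs
open import Data.Empty using (⊥)
open import Data.Fin.Base using (Fin; zero; suc; toℕ)
open import Data.Fin.Properties
  using (_≟_; toℕ<n; toℕ-injective; toℕ-fromℕ<; fromℕ<-injective; fromℕ<-cong)
open import Data.Integer.Base
  using (ℤ; +_; -[1+_]; 0ℤ; 1ℤ; -1ℤ; _+_; _-_; _*_; -_; ∣_∣; _◃_; _⊖_)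
open import Data.Integer.DivMod using (_/ℕ_; _%ℕ_; n%ℕd<d; a≡a%ℕn+[a/ℕn]*n)
open import Data.Integer.Divisibility.Signed
open import Data.Integer.Properties
  using ( ∣i∣≡0⇒i≡0; i≡j⇒i-j≡0; i-j≡0⇒i≡j; +-injective; pos-*; abs-*; +-identityʳ
        ; [+m]-[+n]≡m⊖n; ∣m⊝n∣≤m⊔n; [1+m]⊖[1+n]≡m⊖n)
open import Data.Integer.Tactic.RingSolver using (solve-∀)
open import Data.Nat.Base as ℕ using (ℕ; zero; suc; NonZero; _≤_; _∸_; _^_; s≤s; z≤n)
open import Data.Nat.DivMod using (_%_; _/_; m%n<n; m≡m%n+[m/n]*n; _mod_)
import Data.Nat.Divisibility as ℕ∣
open import Data.Nat.Properties using (m^n≢0)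
import Data.Nat.Properties as ℕ
open import Data.Product.Base using (Σ-syntax; ∃-syntax; _×_; _,_; proj₁; proj₂)
open import Data.Sign.Base as Sign using (Sign; opposite)
open import Data.Sum.Base using (_⊎_; inj₁; inj₂)
open import Data.Vec.Base using ([]; _∷_; lookup)
open import Data.Vec.Properties using (lookup-zipWith; lookup-replicate)
open import Function.Bundles using (_⤖_; module Bijection)
open import Relation.Binary.PropositionalEquality
open import Relation.Nullary using (¬_; yes; no; contradiction)
open import Relation.Nullary.Decidable using (True; toWitness)

-- Divisibility and parity of integers.

∣∧<⇒≡0 : ∀ {m z} → + m ∣ z → ∣ z ∣ ℕ.< m → z ≡ 0ℤ
∣∧<⇒≡0 {m} {z} m∣z z<m = ∣i∣≡0⇒i≡0 (vanishes ∣ z ∣ (∣⇒∣ᵤ m∣z) z<m)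
  where
  vanishes : ∀ a → m ℕ∣.∣ a → a ℕ.< m → a ≡ 0
  vanishes zero    _   _   = refl
  vanishes (suc a) m∣a a<m = contradiction (ℕ∣.∣⇒≤ m∣a) (ℕ.<⇒≱ a<m)

-- The differences from 0 and 1 are the form in which `up-parity` and `down-parity` carry a sign
-- over from these two indices.
parity : ∀ i → (+ 2 ∣ i - 0ℤ) ⊎ (+ 2 ∣ i - 1ℤ)
parity i with i %ℕ 2 | n%ℕd<d i 2 | a≡a%ℕn+[a/ℕn]*n i 2
... | 0 | _ | eq = inj₁ (divides (i /ℕ 2) (trans (cong (_- 0ℤ) eq) (drop 0ℤ _)))
  where
  drop : ∀ r t → r + t - r ≡ t
  drop = solve-∀
... | 1 | _ | eq = inj₂ (divides (i /ℕ 2) (trans (cong (_- 1ℤ) eq) (drop 1ℤ _)))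
  where
  drop : ∀ r t → r + t - r ≡ t
  drop = solve-∀
... | suc (suc _) | s≤s (s≤s ()) | _

-- Signed axes and small values modulo `q`.

Unit : ℕ → Set
Unit n = Fin n × Sign

value : Sign → ℤ
value s = s ◃ 1

opposite-value : ∀ s → value (opposite s) ≡ - value s
opposite-value Sign.+ = refl
opposite-value Sign.- = refl

≢opposite⇒≡ : ∀ s t → t ≢ opposite s → t ≡ s
≢opposite⇒≡ Sign.+ Sign.+ _ = refl
≢opposite⇒≡ Sign.+ Sign.- t≢ = contradiction refl t≢
≢opposite⇒≡ Sign.- Sign.+ t≢ = contradiction refl t≢
≢opposite⇒≡ Sign.- Sign.- _ = refl

-- The source of the modulus 4: coordinates are known only modulo the even number `q`, so their
-- doubles are known modulo 4.
4∣2* : ∀ {q} → 2 ℕ∣.∣ q → ∀ {z} → + q ∣ z → + 4 ∣ + 2 * z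
4∣2* {q} 2∣q q∣z = *-monoʳ-∣ (+ 2) (∣-trans {+ 2} {+ q} (∣ᵤ⇒∣ 2∣q) q∣z)

module _ {q : ℕ} (4≤q : 4 ℕ.≤ q) where

  -- The combinations of signs met below have absolute value at most 3. Once the signs are concrete,
  -- the bound is decided by evaluation.
  small : ∀ {z} {z<4 : True (∣ z ∣ ℕ.<? 4)} → + q ∣ z → z ≡ 0ℤ
  small {z<4 = z<4} q∣z = ∣∧<⇒≡0 q∣z (ℕ.<-≤-trans (toWitness z<4) 4≤q)

  value≢0 : ∀ s → ¬ + q ∣ value s
  value≢0 Sign.+ q∣ = contradiction (small q∣) λ ()
  value≢0 Sign.- q∣ = contradiction (small q∣) λ ()

  2value≢0 : ∀ s → ¬ + q ∣ value s + value s
  2value≢0 Sign.+ q∣ = contradiction (small q∣) λ ()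
  2value≢0 Sign.- q∣ = contradiction (small q∣) λ ()

  opposite-if : ∀ s t → + q ∣ value s + value t → t ≡ opposite s
  opposite-if Sign.+ Sign.+ q∣ = contradiction q∣ (2value≢0 Sign.+)
  opposite-if Sign.+ Sign.- q∣ = refl
  opposite-if Sign.- Sign.+ q∣ = refl
  opposite-if Sign.- Sign.- q∣ = contradiction q∣ (2value≢0 Sign.-)

-- Unit vectors and sums of three consecutive steps.

module _ {n : ℕ} where

  δ : Unit n → Fin n → ℤ
  δ (j , s) k with j ≟ k
  ... | yes _ = value s
  ... | no _  = 0ℤ

  δ-on : ∀ j s → δ (j , s) j ≡ value s
  δ-on j s with j ≟ j
  ... | yes _  = refl
  ... | no j≢j = contradiction refl j≢j

  δ-off : ∀ {j k} s → j ≢ k → δ (j , s) k ≡ 0ℤ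
  δ-off {j} {k} s j≢k with j ≟ k
  ... | yes j≡k = contradiction j≡k j≢k
  ... | no _    = refl

  reverse : Unit n → Unit n
  reverse (j , s) = j , opposite s

  δ-reverse : ∀ a k → δ a k + δ (reverse a) k ≡ 0ℤ
  δ-reverse (j , s) k with j ≟ k | s
  ... | yes _ | Sign.+ = refl
  ... | yes _ | Sign.- = refl
  ... | no _  | _      = refl

  -- If `j` is the axis of `a`, this is twice the `j`-th coordinate of the midpoint of the edge
  -- leaving `x` along `a`.
  phase : (Fin n → ℤ) → Unit n → Fin n → ℤ
  phase x a j = + 2 * x j + value (proj₂ a)

  -- `u-turn` is three sides of a unit square. `straight` sums to a unit vector only for `q` equal
  -- to 4, where 3 is congruent to -1; it preserves the phase modulo 4 too, so both cases are
  -- carried along.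
  data Turn (a b c : Unit n) : Set where
    u-turn   : proj₁ b ≢ proj₁ a → c ≡ reverse a → Turn a b c
    straight : b ≡ a → c ≡ a → Turn a b c

  module _ {q : ℕ} (4≤q : 4 ℕ.≤ q) where

    reverse-if : ∀ a b → (∀ k → + q ∣ δ a k + δ b k) → b ≡ reverse a
    reverse-if (j , s) (j′ , t) q∣ with j ≟ j′ | q∣ j
    ... | no j≢j′  | q∣ⱼ rewrite δ-on j s | δ-off t (≢-sym j≢j′) =
      contradiction (subst (+ q ∣_) (+-identityʳ (value s)) q∣ⱼ) (value≢0 4≤q s)
    ... | yes refl | q∣ⱼ rewrite δ-on j s | δ-on j t = cong (j ,_) (opposite-if 4≤q s t q∣ⱼ)

    -- The left side is ± 1, ± 2 or ± 3. The summand `0ℤ` is the trace of a perpendicular third step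
    -- in `turn`.
    2value≢δ : ∀ s a k → ¬ + q ∣ value s + value s + 0ℤ - δ a k
    2value≢δ s (j , t) k q∣ with j ≟ k | s | t
    ... | yes _ | Sign.+ | Sign.+ = contradiction (small 4≤q q∣) λ ()
    ... | yes _ | Sign.+ | Sign.- = contradiction (small 4≤q q∣) λ ()
    ... | yes _ | Sign.- | Sign.+ = contradiction (small 4≤q q∣) λ ()
    ... | yes _ | Sign.- | Sign.- = contradiction (small 4≤q q∣) λ ()
    ... | no _  | Sign.+ | _      = contradiction (small 4≤q q∣) λ ()
    ... | no _  | Sign.- | _      = contradiction (small 4≤q q∣) λ ()

    -- Neighbouring steps on one axis are equal, as backtracking is excluded. If exactly two
    -- neighbours are parallel, their axis receives ± 2, which no coordinate of `f` matches.
    turn : ∀ a b c f → (∀ k → + q ∣ δ a k + δ b k + δ c k - δ f k) →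
           b ≢ reverse a → c ≢ reverse b → Turn a b c
    turn (j , s) (j′ , s′) (j″ , s″) f q∣ b≢-a c≢-b with j ≟ j′ | j ≟ j″ | j′ ≟ j″
    ... | yes refl | yes refl | _ = straight (cong (j ,_) s′≡s) (cong (j ,_) (trans s″≡s′ s′≡s))
      where
      s′≡s : s′ ≡ s
      s′≡s = ≢opposite⇒≡ s s′ (λ eq → b≢-a (cong (j ,_) eq))
      s″≡s′ : s″ ≡ s′
      s″≡s′ = ≢opposite⇒≡ s′ s″ (λ eq → c≢-b (cong (j ,_) eq))
    ... | yes refl | no j≢j″ | _
      with refl ← ≢opposite⇒≡ s s′ (λ eq → b≢-a (cong (j ,_) eq)) | q∣ⱼ ← q∣ j
      rewrite δ-on j s | δ-off s″ (≢-sym j≢j″) = contradiction q∣ⱼ (2value≢δ s f j)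
    ... | no j≢j′ | _ | yes refl
      with refl ← ≢opposite⇒≡ s′ s″ (λ eq → c≢-b (cong (j′ ,_) eq)) | q∣ⱼ ← q∣ j′
      rewrite δ-on j′ s′ | δ-off s j≢j′ =
      contradiction (subst (+ q ∣_) (lemma (value s′) (δ f j′)) q∣ⱼ) (2value≢δ s′ f j′)
      where
      lemma : ∀ v w → 0ℤ + v + v - w ≡ v + v + 0ℤ - w
      lemma = solve-∀
    -- The middle step is perpendicular to both others, so its coordinate survives and `f` lies on
    -- its axis. On the axis of the first step the sum must then vanish, which only an opposite
    -- third step achieves.
    turn (j , s) (j′ , s′) (j″ , s″) (i , t) q∣ b≢-a c≢-b | no j≢j′ | j≟j″ | no j′≢j″
      with i ≟ j′ | q∣ j′
    ... | no i≢j′ | q∣ⱼ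
      rewrite δ-on j′ s′ | δ-off s j≢j′ | δ-off s″ (≢-sym j′≢j″) =
      contradiction (subst (+ q ∣_) (lemma (value s′)) q∣ⱼ) (value≢0 4≤q s′)
      where
      lemma : ∀ v → 0ℤ + v + 0ℤ - 0ℤ ≡ v
      lemma = solve-∀
    ... | yes refl | _ with j≟j″ | q∣ j
    ... | no j≢j″  | q∣ⱼ
      rewrite δ-on j s | δ-off s′ (≢-sym j≢j′) | δ-off s″ (≢-sym j≢j″) | δ-off t (≢-sym j≢j′) =
      contradiction (subst (+ q ∣_) (lemma (value s)) q∣ⱼ) (value≢0 4≤q s)
      where
      lemma : ∀ v → v + 0ℤ + 0ℤ - 0ℤ ≡ v
      lemma = solve-∀
    ... | yes refl | q∣ⱼ
      rewrite δ-on j s | δ-on j s″ | δ-off s′ (≢-sym j≢j′) | δ-off t (≢-sym j≢j′) =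
      u-turn (≢-sym j≢j′)
        (cong (j ,_) (opposite-if 4≤q s s″ (subst (+ q ∣_) (lemma (value s) (value s″)) q∣ⱼ)))
      where
      lemma : ∀ v w → v + 0ℤ + w - 0ℤ ≡ v + w
      lemma = solve-∀

  -- In a u-turn the first and third edges are opposite sides of a square, so their midpoints agree
  -- on the axis `j`. Going straight moves the midpoint by 2, hence its double by 4.
  turn-phase : ∀ {q} → 2 ℕ∣.∣ q → ∀ {a b c} (x y z : Fin n → ℤ) →
    (∀ k → + q ∣ y k - x k - δ a k) → (∀ k → + q ∣ z k - y k - δ b k) → Turn a b c →
    proj₁ c ≡ proj₁ a × + 4 ∣ phase z c (proj₁ a) - phase x a (proj₁ a)
  turn-phase 2∣q {j , s} {j′ , s′} x y z step₁ step₂ (u-turn j′≢j refl)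
    with step₁ⱼ ← step₁ j | step₂ⱼ ← step₂ j
    rewrite δ-on j s | δ-off s′ j′≢j | opposite-value s =
    refl , subst (+ 4 ∣_) (combine (x j) (y j) (z j) (value s))
      (∣m∣n⇒∣m+n (4∣2* 2∣q step₁ⱼ) (4∣2* 2∣q step₂ⱼ))
    where
    combine : ∀ x y z v →
      + 2 * (y - x - v) + + 2 * (z - y - 0ℤ) ≡ + 2 * z + - v - (+ 2 * x + v)
    combine = solve-∀
  turn-phase 2∣q {j , s} x y z step₁ step₂ (straight refl refl)
    with step₁ⱼ ← step₁ j | step₂ⱼ ← step₂ j
    rewrite δ-on j s =
    refl , subst (+ 4 ∣_) (combine (x j) (y j) (z j) (value s))
      (∣m∣n⇒∣m+n (∣m∣n⇒∣m+n (4∣2* 2∣q step₁ⱼ) (4∣2* 2∣q step₂ⱼ))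
        (divides (value s) refl))
    where
    combine : ∀ x y z v →
      + 2 * (y - x - v) + + 2 * (z - y - v) + v * + 4 ≡ + 2 * z + v - (+ 2 * x + v)
    combine = solve-∀

-- Closed walks modulo `q`, with integer indices and integer coordinates.

module ShiftedCycle
  {n q M N : ℕ} .{{_ : NonZero N}}
  (4≤q : 4 ℕ.≤ q) (2∣q : 2 ℕ∣.∣ q) (2≤M : 2 ℕ.≤ M) (2∣M : 2 ℕ∣.∣ M) (N≡q*M : N ≡ q ℕ.* M)
  (X : ℤ → Fin n → ℤ)
  (separated : ∀ i j → (∀ k → + q ∣ X i k - X j k) → + N ∣ i - j)
  (periodic : ∀ i j → + N ∣ i - j → ∀ k → X i k ≡ X j k)
  (d : ℤ → Unit n)
  (step : ∀ i k → + q ∣ X (i + 1ℤ) k - X i k - δ (d i) k)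
  where

  q<N : q ℕ.< N
  q<N = begin-strict
    q        ≡⟨ ℕ.*-identityʳ q ⟨
    q ℕ.* 1  <⟨ ℕ.*-monoʳ-< q {{ℕ.>-nonZero (ℕ.≤-trans (s≤s z≤n) 4≤q)}} 2≤M ⟩
    q ℕ.* M  ≡⟨ N≡q*M ⟨
    N        ∎
    where open ℕ.≤-Reasoning

  -- The index differences to be excluded later are 2 and ± `q`.
  N∤ : ∀ {z} → ∣ z ∣ ℕ.≤ q → z ≢ 0ℤ → ¬ + N ∣ z
  N∤ z≤q z≢0 N∣z = z≢0 (∣∧<⇒≡0 N∣z (ℕ.≤-<-trans z≤q q<N))

  N∤2 : ¬ + N ∣ + 2
  N∤2 = N∤ (ℕ.≤-trans (s≤s (s≤s z≤n)) 4≤q) λ ()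

  step′ : ∀ i j → j ≡ i + 1ℤ → ∀ k → + q ∣ X j k - X i k - δ (d i) k
  step′ i _ refl = step i

  -- Undoing a step would repeat a word two indices later.
  no-backtrack : ∀ i → d (i + 1ℤ) ≢ reverse (d i)
  no-backtrack i eq = N∤2 (subst (+ N ∣_) (double i) (separated (i + + 2) i back))
    where
    double : ∀ i → i + + 2 - i ≡ + 2
    double = solve-∀
    next : ∀ i → i + + 2 ≡ i + 1ℤ + 1ℤ
    next = solve-∀
    combine : ∀ x y z a b → (z - y - b) + (y - x - a) + (a + b) ≡ z - x
    combine = solve-∀
    back : ∀ k → + q ∣ X (i + + 2) k - X i k
    back k = subst (+ q ∣_) (combine (X i k) (X (i + 1ℤ) k) (X (i + + 2) k) (δ (d i) k) (δ (d (i + 1ℤ)) k))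
      (∣m∣n⇒∣m+n (∣m∣n⇒∣m+n (step′ (i + 1ℤ) (i + + 2) (next i) k) (step i k))
        (subst (+ q ∣_) (sym cancel) (divides 0ℤ refl)))
      where
      cancel : δ (d i) k + δ (d (i + 1ℤ)) k ≡ 0ℤ
      cancel rewrite eq = δ-reverse (d i) k

  infix 4 _⟶_
  -- Translation by the all-ones vector, seen on indices.
  _⟶_ : ℤ → ℤ → Set
  i ⟶ j = ∀ k → + q ∣ X j k - (X i k + 1ℤ)

  ⟶-injective : ∀ {i j t} → i ⟶ t → j ⟶ t → + N ∣ i - j
  ⟶-injective {i} {j} {t} p r = separated i j λ k →
    subst (+ q ∣_) (combine (X i k) (X j k) (X t k)) (∣m∣n⇒∣m-n (r k) (p k))
    where
    combine : ∀ x y z → (z - (y + 1ℤ)) - (z - (x + 1ℤ)) ≡ x - y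
    combine = solve-∀

  ⟶-functional : ∀ {i s t} → i ⟶ s → i ⟶ t → + N ∣ s - t
  ⟶-functional {i} {s} {t} p r = separated s t λ k →
    subst (+ q ∣_) (combine (X i k) (X s k) (X t k)) (∣m∣n⇒∣m-n (p k) (r k))
    where
    combine : ∀ x y z → (y - (x + 1ℤ)) - (z - (x + 1ℤ)) ≡ y - z
    combine = solve-∀

  Up Down : ℤ → Set
  Up   i = i ⟶ i + + M + 1ℤ
  Down i = i ⟶ i + + M + -1ℤ

  Up⇒¬Down : ∀ i → Up i → ¬ Down i
  Up⇒¬Down i u v = N∤2 (subst (+ N ∣_) (gap i (+ M)) (⟶-functional u v))
    where
    gap : ∀ i m → i + m + 1ℤ - (i + m + -1ℤ) ≡ + 2
    gap = solve-∀

  module _ (up-or-down : ∀ i → Up i ⊎ Down i) where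

    -- With opposite signs at `i` and `i + + 2`, both arrows would end at `i + + M + 1ℤ`.
    up-next : ∀ i → Up i → Up (i + + 2)
    up-next i u with up-or-down (i + + 2)
    ... | inj₁ u′ = u′
    ... | inj₂ v  = contradiction
      (subst (+ N ∣_) (gap i) (⟶-injective (subst (i + + 2 ⟶_) (target i (+ M)) v) u)) N∤2
      where
      target : ∀ i m → i + + 2 + m + -1ℤ ≡ i + m + 1ℤ
      target = solve-∀
      gap : ∀ i → i + + 2 - i ≡ + 2
      gap = solve-∀

    up-later : ∀ i a → Up i → Up (i + + 2 * + a)
    up-later i zero    u = subst Up (sym (+-identityʳ i)) u
    up-later i (suc a) u = subst Up (later i (+ a)) (up-later (i + + 2) a (up-next i u))
      where
      later : ∀ i a → i + + 2 + + 2 * a ≡ i + + 2 * (1ℤ + a)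
      later = solve-∀

    up-periodic : ∀ i j → + N ∣ i - j → Up i → Up j
    up-periodic i j N∣ u k = subst (+ q ∣_)
      (cong₂ (λ x y → x - (y + 1ℤ))
        (periodic (i + + M + 1ℤ) (j + + M + 1ℤ) (subst (+ N ∣_) (shift i j (+ M)) N∣) k)
        (periodic i j N∣ k))
      (u k)
      where
      shift : ∀ i j m → i - j ≡ i + m + 1ℤ - (j + m + 1ℤ)
      shift = solve-∀

    -- `up-later` only moves forward. Half the distance is therefore replaced by its remainder
    -- modulo `N`, and periodicity absorbs the rest.
    up-parity : ∀ i j → + 2 ∣ j - i → Up i → Up j
    up-parity i j (divides t j-i≡t*2) u =
      up-periodic (i + + 2 * + (t %ℕ N)) j (divides (- (+ 2 * (t /ℕ N))) wrap)
        (up-later i (t %ℕ N) u)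
      where
      regroup : ∀ i j r s n → i + + 2 * r - j ≡ - (j - i) + (r + s * n) * + 2 - + 2 * s * n
      regroup = solve-∀
      collapse : ∀ t s n → - (t * + 2) + t * + 2 - + 2 * s * n ≡ - (+ 2 * s) * n
      collapse = solve-∀
      wrap : i + + 2 * + (t %ℕ N) - j ≡ - (+ 2 * (t /ℕ N)) * + N
      wrap = begin
        i + + 2 * + (t %ℕ N) - j
          ≡⟨ regroup i j (+ (t %ℕ N)) (t /ℕ N) (+ N) ⟩
        - (j - i) + (+ (t %ℕ N) + (t /ℕ N) * + N) * + 2 - + 2 * (t /ℕ N) * + N
          ≡⟨ cong₂ (λ x y → - x + y * + 2 - + 2 * (t /ℕ N) * + N) j-i≡t*2
               (sym (a≡a%ℕn+[a/ℕn]*n t N)) ⟩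
        - (t * + 2) + t * + 2 - + 2 * (t /ℕ N) * + N
          ≡⟨ collapse t (t /ℕ N) (+ N) ⟩
        - (+ 2 * (t /ℕ N)) * + N ∎
        where open ≡-Reasoning

    -- If `j` were up, `up-parity` would carry this back to `i`, which cannot be both up and down.
    down-parity : ∀ i j → + 2 ∣ j - i → Down i → Down j
    down-parity i j 2∣ v with up-or-down j
    ... | inj₁ u  = contradiction v
      (Up⇒¬Down i (up-parity j i (subst (+ 2 ∣_) (flip i j) (∣m⇒∣-m {m = j - i} 2∣)) u))
      where
      flip : ∀ i j → - (j - i) ≡ i - j
      flip = solve-∀
    ... | inj₂ v′ = v′

    -- Translating `q` times is the identity modulo `q`, but moves the index by `q * (M + ε)`, that
    -- is `N + q * ε`; and `q` is below `N`.
    not-constant : ∀ ε → ∣ ε ∣ ≡ 1 → ¬ (∀ i → i ⟶ i + + M + ε)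
    not-constant ε ∣ε∣≡1 go =
      N∤ (ℕ.≤-reflexive ∣qε∣≡q) qε≢0
        (subst (+ N ∣_) total (∣m∣n⇒∣m-n (separated (0ℤ + + q * (+ M + ε)) 0ℤ return) ∣-refl))
      where
      iterate : ∀ a k → + q ∣ X (0ℤ + + a * (+ M + ε)) k - (X 0ℤ k + + a)
      iterate zero k = subst (+ q ∣_) (sym (zeroth (X 0ℤ k))) (divides 0ℤ refl)
        where
        zeroth : ∀ x → x - (x + 0ℤ) ≡ 0ℤ
        zeroth = solve-∀
      iterate (suc a) k = subst (+ q ∣_)
        (trans (combine (X (0ℤ + + a * (+ M + ε) + + M + ε) k) (X (0ℤ + + a * (+ M + ε)) k) (X 0ℤ k) (+ a))
          (cong (λ i → X i k - (X 0ℤ k + + suc a)) (position (+ a) (+ M) ε)))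
        (∣m∣n⇒∣m+n (go (0ℤ + + a * (+ M + ε)) k) (iterate a k))
        where
        combine : ∀ z y x a → (z - (y + 1ℤ)) + (y - (x + a)) ≡ z - (x + (1ℤ + a))
        combine = solve-∀
        position : ∀ a m e → 0ℤ + a * (m + e) + m + e ≡ 0ℤ + (1ℤ + a) * (m + e)
        position = solve-∀
      return : ∀ k → + q ∣ X (0ℤ + + q * (+ M + ε)) k - X 0ℤ k
      return k = subst (+ q ∣_) (combine (X (0ℤ + + q * (+ M + ε)) k) (X 0ℤ k) (+ q)) (∣m∣n⇒∣m+n (iterate q k) ∣-refl)
        where
        combine : ∀ y x a → (y - (x + a)) + a ≡ y - x
        combine = solve-∀
      expand : ∀ a m e → 0ℤ + a * (m + e) - 0ℤ - a * m ≡ a * e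
      expand = solve-∀
      total : 0ℤ + + q * (+ M + ε) - 0ℤ - + N ≡ + q * ε
      total = trans (cong (λ x → 0ℤ + + q * (+ M + ε) - 0ℤ - x)
        (trans (cong +_ N≡q*M) (pos-* q M))) (expand (+ q) (+ M) ε)
      ∣qε∣≡q : ∣ + q * ε ∣ ≡ q
      ∣qε∣≡q = trans (abs-* (+ q) ε) (trans (cong (q ℕ.*_) ∣ε∣≡1) (ℕ.*-identityʳ q))
      qε≢0 : + q * ε ≢ 0ℤ
      qε≢0 eq = ℕ.<⇒≢ (ℕ.≤-trans (s≤s z≤n) 4≤q) (trans (sym (cong ∣_∣ eq)) ∣qε∣≡q)

    -- Alternating signs.

    module _ (i₀ : ℤ) (up₀ : Up i₀) (down₁ : Down (i₀ + 1ℤ)) where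

      -- Parity is taken relative to `i₀`, so that one argument serves both ways of alternating.
      Even : ℤ → Set
      Even i = + 2 ∣ i - i₀

      up : ∀ i → Even i → Up i
      up i even = up-parity i₀ i even up₀

      down : ∀ i → Even i → Down (i + 1ℤ)
      down i even = down-parity (i₀ + 1ℤ) (i + 1ℤ) (subst (+ 2 ∣_) (shift i i₀) even) down₁
        where
        shift : ∀ i j → i - j ≡ i + 1ℤ - (j + 1ℤ)
        shift = solve-∀

      even-next : ∀ i → Even i → Even (i + + 2)
      even-next i even = subst (+ 2 ∣_) (shift i i₀) (∣m∣n⇒∣m+n even ∣-refl)
        where
        shift : ∀ i j → i - j + + 2 ≡ i + + 2 - j
        shift = solve-∀

      down-arrow : ∀ i → Even i → i + 1ℤ ⟶ i + + M
      down-arrow i even = subst (i + 1ℤ ⟶_) (target i (+ M)) (down i even)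
        where
        target : ∀ i m → i + 1ℤ + m + -1ℤ ≡ i + m
        target = solve-∀

      -- Translation sends `i` to `i + + M + 1ℤ` and `i + 1ℤ` to `i + + M`: the edge at `i` goes to
      -- the edge at `i + + M`, run backwards.
      reversed : ∀ i → Even i → d (i + + M) ≡ reverse (d i)
      reversed i even = reverse-if 4≤q (d i) (d (i + + M)) λ k →
        subst (+ q ∣_)
          (combine (X i k) (X (i + 1ℤ) k) (X (i + + M) k) (X (i + + M + 1ℤ) k)
            (δ (d i) k) (δ (d (i + + M)) k))
          (∣m∣n⇒∣m-n (∣m∣n⇒∣m-n (∣m∣n⇒∣m-n (up i even k) (down-arrow i even k))
            (step i k)) (step (i + + M) k))
        where
        combine : ∀ x y z w a b →
          (w - (x + 1ℤ)) - (z - (y + 1ℤ)) - (y - x - a) - (w - z - b) ≡ a + b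
        combine = solve-∀

      -- The ends `i` and `i + + 3` of a path of three steps are translated to the consecutive
      -- indices `i + + M + 1ℤ` and `i + + M + + 2`. So the three steps add up to the single step
      -- between these.
      turns : ∀ i → Even i → Turn (d i) (d (i + 1ℤ)) (d (i + + 2))
      turns i even =
        turn 4≤q (d i) (d (i + 1ℤ)) (d (i + + 2)) (d (i + + M + 1ℤ)) three-steps
          (no-backtrack i)
          (subst (λ j → d j ≢ reverse (d (i + 1ℤ))) (two i) (no-backtrack (i + 1ℤ)))
        where
        two : ∀ i → i + 1ℤ + 1ℤ ≡ i + + 2
        two = solve-∀
        far : ∀ i m → i + + 2 + m ≡ i + m + 1ℤ + 1ℤ
        far = solve-∀
        combine : ∀ x y z w v u a b c f →
          (v - (w + 1ℤ)) - (u - (x + 1ℤ)) + (w - z - c) + (z - y - b) + (y - x - a) - (v - u - f)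
          ≡ - (a + b + c - f)
        combine = solve-∀
        negate : ∀ a → - (- a) ≡ a
        negate = solve-∀
        three-steps : ∀ k → + q ∣
          δ (d i) k + δ (d (i + 1ℤ)) k + δ (d (i + + 2)) k - δ (d (i + + M + 1ℤ)) k
        three-steps k = subst (+ q ∣_) (negate _) (∣m⇒∣-m (subst (+ q ∣_)
          (combine (X i k) (X (i + 1ℤ) k) (X (i + + 2) k) (X (i + + 2 + 1ℤ) k)
            (X (i + + 2 + + M) k) (X (i + + M + 1ℤ) k)
            (δ (d i) k) (δ (d (i + 1ℤ)) k) (δ (d (i + + 2)) k) (δ (d (i + + M + 1ℤ)) k))
          (∣m∣n⇒∣m-n
            (∣m∣n⇒∣m+n
              (∣m∣n⇒∣m+n
                (∣m∣n⇒∣m+n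
                  (∣m∣n⇒∣m-n (down-arrow (i + + 2) (even-next i even) k) (up i even k))
                  (step (i + + 2) k))
                (step′ (i + 1ℤ) (i + + 2) (sym (two i)) k))
              (step i k))
            (step′ (i + + M + 1ℤ) (i + + 2 + + M) (far i (+ M)) k))))

      axis : ℤ → Fin n
      axis i = proj₁ (d i)

      phaseAt : ℤ → Fin n → ℤ
      phaseAt i = phase (X i) (d i)

      InPhase : ℤ → ℤ → Set
      InPhase i j = axis j ≡ axis i × + 4 ∣ phaseAt j (axis i) - phaseAt i (axis i)

      inPhase-refl : ∀ i → InPhase i i
      inPhase-refl i = refl ,
        subst (+ 4 ∣_) (sym (i≡j⇒i-j≡0 {phaseAt i (axis i)} refl)) (divides 0ℤ refl)

      inPhase-trans : ∀ i j k → InPhase i j → InPhase j k → InPhase i k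
      inPhase-trans i j k (axis₁ , 4∣₁) (axis₂ , 4∣₂) = trans axis₂ axis₁ ,
        subst (+ 4 ∣_) (combine (phaseAt i (axis i)) (phaseAt j (axis i)) (phaseAt k (axis i)))
          (∣m∣n⇒∣m+n 4∣₁ (subst (λ a → + 4 ∣ phaseAt k a - phaseAt j a) axis₁ 4∣₂))
        where
        combine : ∀ x y z → (y - x) + (z - y) ≡ z - x
        combine = solve-∀

      inPhase-next : ∀ i → Even i → InPhase i (i + + 2)
      inPhase-next i even = turn-phase 2∣q (X i) (X (i + 1ℤ)) (X (i + + 2))
        (step i) (step′ (i + 1ℤ) (i + + 2) (two i)) (turns i even)
        where
        two : ∀ i → i + + 2 ≡ i + 1ℤ + 1ℤ
        two = solve-∀

      inPhase-later : ∀ i a → Even i → InPhase i (i + + 2 * + a)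
      inPhase-later i zero    even = subst (InPhase i) (sym (+-identityʳ i)) (inPhase-refl i)
      inPhase-later i (suc a) even =
        subst (InPhase i) (later i (+ a))
          (inPhase-trans i (i + + 2) (i + + 2 + + 2 * + a)
            (inPhase-next i even) (inPhase-later (i + + 2) a (even-next i even)))
        where
        later : ∀ i a → i + + 2 + + 2 * a ≡ i + + 2 * (1ℤ + a)
        later = solve-∀

      -- As `M` is even, `i + + M` is reached from `i` by double steps.
      inPhase-M : ∀ i → Even i → InPhase i (i + + M)
      inPhase-M i even = subst (λ m → InPhase i (i + m)) 2a≡M (inPhase-later i a even)
        where
        a : ℕ
        a = ℕ∣.quotient 2∣M
        2a≡M : + 2 * + a ≡ + M
        2a≡M = trans (sym (pos-* 2 a))
          (cong +_ (trans (ℕ.*-comm 2 a) (sym (ℕ∣._∣_.equality 2∣M))))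

      -- Up to direction, the edge at `i + + M` is the edge at `i` translated by the all-ones
      -- vector. Its midpoint moves by 1 on every axis, so the phase changes by 2, which is not 0
      -- modulo 4.
      ¬inPhase-M : ∀ i → Even i → ¬ InPhase i (i + + M)
      ¬inPhase-M i even (_ , 4∣) = contradiction (∣∧<⇒≡0 4∣2 (s≤s (s≤s (s≤s z≤n)))) λ ()
        where
        j : Fin n
        j = axis i
        v : ℤ
        v = value (proj₂ (d i))
        change : phaseAt (i + + M) j ≡ + 2 * X (i + + M) j + - v
        change = cong (λ w → + 2 * X (i + + M) j + w)
          (trans (cong (λ a → value (proj₂ a)) (reversed i even)) (opposite-value (proj₂ (d i))))
        combine : ∀ x y z v →
          + 2 * z + - v - (+ 2 * x + v) - + 2 * (z - (y + 1ℤ)) - + 2 * (y - x - v) ≡ + 2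
        combine = solve-∀
        step-j : + q ∣ X (i + 1ℤ) j - X i j - v
        step-j = subst (λ w → + q ∣ X (i + 1ℤ) j - X i j - w) (δ-on j (proj₂ (d i))) (step i j)
        4∣2 : + 4 ∣ + 2
        4∣2 = subst (+ 4 ∣_) (combine (X i j) (X (i + 1ℤ) j) (X (i + + M) j) v)
          (∣m∣n⇒∣m-n
            (∣m∣n⇒∣m-n (subst (λ p → + 4 ∣ p - phaseAt i j) change 4∣)
              (4∣2* 2∣q (down-arrow i even j)))
            (4∣2* 2∣q step-j))

      alternating-impossible : ⊥
      alternating-impossible = ¬inPhase-M i₀ even₀ (inPhase-M i₀ even₀)
        where
        even₀ : Even i₀
        even₀ = subst (+ 2 ∣_) (sym (i≡j⇒i-j≡0 {i₀} refl)) (divides 0ℤ refl)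

  impossible : ¬ (∀ i → Up i ⊎ Down i)
  impossible up-or-down with up-or-down 0ℤ | up-or-down 1ℤ
  ... | inj₁ u₀ | inj₁ u₁ = not-constant up-or-down 1ℤ refl all-up
    where
    all-up : ∀ i → Up i
    all-up i with parity i
    ... | inj₁ even = up-parity up-or-down 0ℤ i even u₀
    ... | inj₂ odd  = up-parity up-or-down 1ℤ i odd u₁
  ... | inj₂ v₀ | inj₂ v₁ = not-constant up-or-down -1ℤ refl all-down
    where
    all-down : ∀ i → Down i
    all-down i with parity i
    ... | inj₁ even = down-parity up-or-down 0ℤ i even v₀
    ... | inj₂ odd  = down-parity up-or-down 1ℤ i odd v₁
  ... | inj₁ u₀ | inj₂ v₁ = alternating-impossible up-or-down 0ℤ u₀ v₁
  -- Here the odd indices are up, so the base is 1 and its successor 2 inherits the sign of 0.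
  ... | inj₂ v₀ | inj₁ u₁ =
    alternating-impossible up-or-down 1ℤ u₁ (down-parity up-or-down 0ℤ (+ 2) (divides 1ℤ refl) v₀)

-- Residues and indices modulo `m`.

residues-≡ : ∀ {m a b} → a ℕ.< m → b ℕ.< m → + m ∣ + a - + b → a ≡ b
residues-≡ {m} {a} {b} a<m b<m m∣ = +-injective (i-j≡0⇒i≡j (+ a) (+ b) (∣∧<⇒≡0 m∣ (begin-strict
  ∣ + a - + b ∣  ≡⟨ cong ∣_∣ ([+m]-[+n]≡m⊖n a b) ⟩
  ∣ a ⊖ b ∣      ≤⟨ ∣m⊝n∣≤m⊔n a b ⟩
  a ℕ.⊔ b        <⟨ ℕ.⊔-lub a<m b<m ⟩
  m              ∎)))
  where open ℕ.≤-Reasoning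

%ℕ-∣ : ∀ i m .{{_ : NonZero m}} → + m ∣ i - + (i %ℕ m)
%ℕ-∣ i m = divides (i /ℕ m)
  (trans (cong (_- + (i %ℕ m)) (a≡a%ℕn+[a/ℕn]*n i m)) (drop (+ (i %ℕ m)) (i /ℕ m * + m)))
  where
  drop : ∀ r t → r + t - r ≡ t
  drop = solve-∀

index-≡⇒∣ : ∀ m .{{_ : NonZero m}} i j → index m i ≡ index m j → + m ∣ i - j
index-≡⇒∣ m i j eq = subst (+ m ∣_) (combine i j (+ (i %ℕ m)))
  (∣m∣n⇒∣m-n (%ℕ-∣ i m)
    (subst (λ r → + m ∣ j - + r)
      (sym (fromℕ<-injective _ _ (n%ℕd<d i m) (n%ℕd<d j m) eq)) (%ℕ-∣ j m)))
  where
  combine : ∀ i j r → (i - r) - (j - r) ≡ i - j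
  combine = solve-∀

index-∣⇒≡ : ∀ m .{{_ : NonZero m}} i j → + m ∣ i - j → index m i ≡ index m j
index-∣⇒≡ m i j m∣ = fromℕ<-cong _ _
  (residues-≡ (n%ℕd<d i m) (n%ℕd<d j m)
    (subst (+ m ∣_) (combine i j (+ (i %ℕ m)) (+ (j %ℕ m)))
      (∣m∣n⇒∣m+n (∣m∣n⇒∣m-n m∣ (%ℕ-∣ i m)) (%ℕ-∣ j m))))
  (n%ℕd<d i m) (n%ℕd<d j m)
  where
  combine : ∀ i j r s → (i - j) - (i - r) + (j - s) ≡ r - s
  combine = solve-∀

-- Words as integer vectors modulo `q`.

coordinate : ∀ {q n} → Word q n → Fin n → ℤ
coordinate v k = + toℕ (lookup v k)

coordinate-injective : ∀ {q n} (v u : Word q n) →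
  (∀ k → + q ∣ coordinate v k - coordinate u k) → v ≡ u
coordinate-injective []      []      _  = refl
coordinate-injective (x ∷ v) (y ∷ u) q∣ =
  cong₂ _∷_ (toℕ-injective (residues-≡ (toℕ<n x) (toℕ<n y) (q∣ zero)))
    (coordinate-injective v u (λ k → q∣ (suc k)))

mod-∣ : ∀ a q .{{_ : NonZero q}} → + q ∣ + toℕ (a mod q) - + a
mod-∣ a q = subst (λ r → + q ∣ + r - + a) (sym (toℕ-fromℕ< (m%n<n a q)))
  (divides (- + (a / q)) (trans (cong (λ b → + (a % q) - b) split) (drop (+ (a % q)) (+ (a / q)) (+ q))))
  where
  split : + a ≡ + (a % q) + + (a / q) * + q
  split = trans (cong +_ (m≡m%n+[m/n]*n a q))
    (cong (λ b → + (a % q) + b) (pos-* (a / q) q))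
  drop : ∀ r t q → r - (r + t * q) ≡ - t * q
  drop = solve-∀

⊕𝟏-coordinate : ∀ {q n} .{{_ : NonZero q}} → (v : Word q n) → ∀ k →
  + q ∣ coordinate (v ⊕ 𝟏) k - (coordinate v k + 1ℤ)
⊕𝟏-coordinate {q} {n} v k
  rewrite lookup-zipWith _⊕₁_ k v 𝟏 | lookup-replicate {n = n} k (1 mod q) =
  subst (+ q ∣_)
    (combine (+ toℕ (lookup v k ⊕₁ (1 mod q))) (coordinate v k) (+ toℕ (1 mod q)))
    (∣m∣n⇒∣m+n (mod-∣ (toℕ (lookup v k) ℕ.+ toℕ (1 mod q)) q) (mod-∣ 1 q))
  where
  combine : ∀ s x y → s - (x + y) + (y - 1ℤ) ≡ s - (x + 1ℤ)
  combine = solve-∀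

-- Words at Lee distance 0 and 1.

∣-∣≡∣⊖∣ : ∀ a b → ℕ.∣ a - b ∣ ≡ ∣ b ⊖ a ∣
∣-∣≡∣⊖∣ zero    b       = refl
∣-∣≡∣⊖∣ (suc a) zero    = refl
∣-∣≡∣⊖∣ (suc a) (suc b) = trans (∣-∣≡∣⊖∣ a b) (cong ∣_∣ (sym ([1+m]⊖[1+n]≡m⊖n b a)))

-- Two residues differ by less than `q`, so the wrapped distance is positive and the minimum
-- vanishes only through the direct one.
leeDist₁≡0⇒≡ : ∀ {q} (a b : Fin q) → leeDist₁ a b ≡ 0 → a ≡ b
leeDist₁≡0⇒≡ {q} a b eq with ℕ.⊓-sel ℕ.∣ toℕ a - toℕ b ∣ (q ℕ.∸ ℕ.∣ toℕ a - toℕ b ∣)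
... | inj₁ near = toℕ-injective (ℕ.∣m-n∣≡0⇒m≡n (trans (sym near) eq))
... | inj₂ far  = contradiction (ℕ.m∸n≡0⇒m≤n (trans (sym far) eq))
  (ℕ.<⇒≱ (ℕ.≤-<-trans (ℕ.∣m-n∣≤m⊔n (toℕ a) (toℕ b)) (ℕ.⊔-lub (toℕ<n a) (toℕ<n b))))

leeDist≡0⇒≡ : ∀ {q n} (v u : Word q n) → leeDist v u ≡ 0 → v ≡ u
leeDist≡0⇒≡ []      []      _  = refl
leeDist≡0⇒≡ (x ∷ v) (y ∷ u) eq =
  cong₂ _∷_ (leeDist₁≡0⇒≡ x y (ℕ.m+n≡0⇒m≡0 (leeDist₁ x y) eq))
    (leeDist≡0⇒≡ v u (ℕ.m+n≡0⇒n≡0 (leeDist₁ x y) eq))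

-- The second alternative is a step between the residues 0 and q - 1, where the sign flips.
near-or-wrap : ∀ {q} z → (∣ z ∣ ≡ 1) ⊎ (suc ∣ z ∣ ≡ q) → ∃[ s ] + q ∣ z - value s
near-or-wrap (+ 1)          (inj₁ refl) = Sign.+ , divides 0ℤ refl
near-or-wrap -[1+ 0 ]       (inj₁ refl) = Sign.- , divides 0ℤ refl
near-or-wrap (+ a)          (inj₂ refl) = Sign.- , divides 1ℤ (lemma (+ a))
  where
  lemma : ∀ a → a - -1ℤ ≡ 1ℤ * (1ℤ + a)
  lemma = solve-∀
near-or-wrap -[1+ a ]       (inj₂ refl) = Sign.+ , divides -1ℤ (lemma (+ a))
  where
  lemma : ∀ a → - (1ℤ + a) - 1ℤ ≡ -1ℤ * (1ℤ + (1ℤ + a))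
  lemma = solve-∀

leeDist₁≡1⇒step : ∀ {q} (a b : Fin q) → leeDist₁ a b ≡ 1 → ∃[ s ] + q ∣ + toℕ b - + toℕ a - value s
leeDist₁≡1⇒step {q} a b eq = near-or-wrap (+ toℕ b - + toℕ a) cases
  where
  D : ℕ
  D = ℕ.∣ toℕ a - toℕ b ∣
  D≡ : ∣ + toℕ b - + toℕ a ∣ ≡ D
  D≡ = trans (cong ∣_∣ ([+m]-[+n]≡m⊖n (toℕ b) (toℕ a))) (sym (∣-∣≡∣⊖∣ (toℕ a) (toℕ b)))
  D≤q : D ℕ.≤ q
  D≤q = ℕ.≤-trans (ℕ.∣m-n∣≤m⊔n (toℕ a) (toℕ b)) (ℕ.<⇒≤ (ℕ.⊔-lub (toℕ<n a) (toℕ<n b)))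
  cases : (∣ + toℕ b - + toℕ a ∣ ≡ 1) ⊎ (suc ∣ + toℕ b - + toℕ a ∣ ≡ q)
  cases rewrite D≡ with ℕ.⊓-sel D (q ℕ.∸ D)
  ... | inj₁ near = inj₁ (trans (sym near) eq)
  ... | inj₂ far  = inj₂ (trans (cong (ℕ._+ D) (trans (sym eq) far)) (ℕ.m∸n+n≡m D≤q))

δ-suc : ∀ {n} (j : Fin n) s k → δ (suc j , s) (suc k) ≡ δ (j , s) k
δ-suc j s k with j ≟ k
... | yes _ = refl
... | no _  = refl

-- A sum of naturals equal to 1 has one summand 1 and all others 0; the position of that summand is
-- the axis.
leeDist≡1⇒step : ∀ {q n} (v u : Word q n) → leeDist v u ≡ 1 →
  Σ[ a ∈ Unit n ] (∀ k → + q ∣ coordinate u k - coordinate v k - δ a k)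
leeDist≡1⇒step []      []      ()
leeDist≡1⇒step {q} (x ∷ v) (y ∷ u) eq with leeDist₁ x y in eq₁
... | 0 with refl ← leeDist₁≡0⇒≡ x y eq₁ | (j , s) , q∣ ← leeDist≡1⇒step v u eq =
  (suc j , s) , λ where
    zero    → subst (+ q ∣_) (sym (cancel (+ toℕ x))) (divides 0ℤ refl)
    (suc k) → subst (λ w → + q ∣ coordinate u k - coordinate v k - w) (sym (δ-suc j s k)) (q∣ k)
  where
  cancel : ∀ x → x - x - 0ℤ ≡ 0ℤ
  cancel = solve-∀
... | 1 with s , q∣ ← leeDist₁≡1⇒step x y eq₁ | refl ← leeDist≡0⇒≡ v u (ℕ.suc-injective eq) =
  (zero , s) , λ where
    zero    → q∣
    (suc k) → subst (+ q ∣_) (sym (cancel (coordinate v k))) (divides 0ℤ refl)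
  where
  cancel : ∀ x → x - x - 0ℤ ≡ 0ℤ
  cancel = solve-∀

-- From an ordering of all words to a shifted cycle.

theorem4 :
    ∀ (q n : ℕ) .{{_ : NonZero q}} →
    4 ≤ q → 2 ℕ∣.∣ q → 3 ≤ n → 2 ℕ∣.∤ n →
    let N = q ^ n
        at : (Fin N ⤖ Word q n) → ℤ → Word q n
        at G k = Bijection.to G (index N {{m^n≢0 q n}} k)
    in
    ¬ (Σ[ G ∈ (Fin N ⤖ Word q n) ]
        (∀ (i : ℤ) → leeDist (at G i) (at G (i + 1ℤ)) ≡ 1) ×
        (∀ (i : ℤ) → ∃[ ε ] (ε ≡ 1ℤ ⊎ ε ≡ -1ℤ) ×
          at G i ⊕ 𝟏 ≡ at G (i + + (q ^ (n ∸ 1)) + ε)))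
-- Opening `n` twice makes `q ^ n` compute to `q` times `M`, and exposes a factor `q` in `M`, which
-- makes `M` even and at least 2.
theorem4 q n@(suc n-1@(suc n-2)) 4≤q 2∣q 3≤n _ (G , adjacent , shifted) =
  ShiftedCycle.impossible 4≤q 2∣q 2≤M (ℕ∣.∣m⇒∣m*n (q ^ n-2) 2∣q) refl
    X separated periodic d step up-or-down
  where
  instance
    N≢0 : NonZero (q ^ n)
    N≢0 = m^n≢0 q n
    q^n-2≢0 : NonZero (q ^ n-2)
    q^n-2≢0 = m^n≢0 q n-2
  2≤M : 2 ≤ q ^ n-1
  2≤M = ℕ.≤-trans (ℕ.≤-trans (s≤s (s≤s z≤n)) 4≤q) (ℕ.m≤m*n q (q ^ n-2))
  g : ℤ → Word q n
  g i = Bijection.to G (index (q ^ n) i)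
  X : ℤ → Fin n → ℤ
  X i = coordinate (g i)
  separated : ∀ i j → (∀ k → + q ∣ X i k - X j k) → + (q ^ n) ∣ i - j
  separated i j q∣ =
    index-≡⇒∣ (q ^ n) i j (Bijection.injective G (coordinate-injective (g i) (g j) q∣))
  periodic : ∀ i j → + (q ^ n) ∣ i - j → ∀ k → X i k ≡ X j k
  periodic i j N∣ k =
    cong (λ r → coordinate (Bijection.to G r) k) (index-∣⇒≡ (q ^ n) i j N∣)
  d : ℤ → Unit n
  d i = proj₁ (leeDist≡1⇒step (g i) (g (i + 1ℤ)) (adjacent i))
  step : ∀ i k → + q ∣ X (i + 1ℤ) k - X i k - δ (d i) k
  step i = proj₂ (leeDist≡1⇒step (g i) (g (i + 1ℤ)) (adjacent i))
  arrow : ∀ i j → g i ⊕ 𝟏 ≡ g j → ∀ k → + q ∣ X j k - (X i k + 1ℤ)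
  arrow i j eq k =
    subst (λ w → + q ∣ coordinate w k - (X i k + 1ℤ)) eq (⊕𝟏-coordinate (g i) k)
  up-or-down : ∀ i →
    (∀ k → + q ∣ X (i + + (q ^ n-1) + 1ℤ) k - (X i k + 1ℤ)) ⊎
    (∀ k → + q ∣ X (i + + (q ^ n-1) + -1ℤ) k - (X i k + 1ℤ))
  up-or-down i with shifted i
  ... | _ , inj₁ refl , eq = inj₁ (arrow i (i + + (q ^ n-1) + 1ℤ) eq)
  ... | _ , inj₂ refl , eq = inj₂ (arrow i (i + + (q ^ n-1) + -1ℤ) eq)
theorem4 q 1 _ _ (s≤s ()) _ _
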